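{- Let $\mathbb C$ be a strict Cartesian category. The delayed trace operator on $\mathrm{St}(\mathbb C)$ satisfies the following equalities of morphisms of $\mathrm{St}(\mathbb C)$. Let $(i,\mathbf s):\mathbf T\times\mathbf X\to\bigcirc\mathbf T\times\mathbf Y$, $(h,\mathbf r):\mathbf Y\to\mathbf Z$, $(j,\mathbf t):\mathbf W\to\mathbf X$ and $(f,\mathbf p):\mathbf W\to\mathbf Z$ be arbitrary morphisms of $\mathrm{St}(\mathbb C)$ and $q:1\to\mathbf T_0$ a morphism of $\mathbb C$. Then: (Target naturality) $(h,\mathbf r)\circ\mathrm{tr}^{\mathbf T}_q(i,\mathbf s)=\mathrm{tr}^{\mathbf T}_q\big((\mathrm{id}_{\bigcirc\mathbf T}\times(h,\mathbf r))\circ(i,\mathbf s)\big)$. (Source naturality) $\mathrm{tr}^{\mathbf T}_q(i,\mathbf s)\circ(j,\mathbf t)=\mathrm{tr}^{\mathbf T}_q\big((i,\mathbf s)\circ(\mathrm{id}_{\mathbf T}\times(j,\mathbf t))\big)$. (Superposing) $\mathrm{tr}^{\mathbf T}_q(i,\mathbf s)\times(f,\mathbf p)=\mathrm{tr}^{\mathbf T}_q\big((i,\mathbf s)\times(f,\mathbf p)\big)$. (Vanishing 1) If $\mathbf T=[1]$, then $\mathrm{tr}^{[1]}_{\mathrm{id}_1}(i,\mathbf s)=(i,\mathbf s)$. (Vanishing $\times$) For every morphism $(i,\mathbf s):\mathbf U\times\mathbf V\times\mathbf X\to\bigcirc\mathbf U\times\bigcirc\mathbf V\times\mathbf Y$ of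 $\mathrm{St}(\mathbb C)$ and all $p:1\to\mathbf U_0$, $q:1\to\mathbf V_0$ in $\mathbb C$, $\mathrm{tr}^{\mathbf V}_q\big(\mathrm{tr}^{\mathbf U}_p(i,\mathbf s)\big)=\mathrm{tr}^{[\mathbf U_k\times\mathbf V_k]_k}_{\langle p,q\rangle}(i,\mathbf s)$.
   Context: $\mathbb C$ is a Cartesian category with strictly associative and unital chosen products $\times$, terminal object $1$, $!_X:X\to1$. Equations between morphisms are written with generalized elements. Sequences are indexed by $\mathbb N$; $[e_k]_k$ is the sequence with $k$th entry $e_k$, $[X]$ the constant sequence, and $\bigcirc\mathbf T=[\mathbf T_{k+1}]_k$ the tail. 2-cells: a 2-cell $f$ consists of objects $S=\mathrm{prv}\,f$, $X=\mathrm{dom}\,f$, $S'=\mathrm{nxt}\,f$, $Y=\mathrm{cod}\,f$ together with an underlying morphism $Uf:S\times X\to S'\times Y$ in $\mathbb C$ ($S,S'$ are state types, $X,Y$ value types). Horizontal composition: if also $g$ has $Ug:T\times Y\to T'\times Z$, then $g*f$ has $\mathrm{prv}=S\times T$, $\mathrm{dom}=X$, $\mathrm{nxt}=S'\times T'$, $\mathrm{cod}=Z$ and $U(g*f)(s,t,x)=(s',t',z)$ where $(s',y)=Uf(s,x)$, $(t',z)=Ug(t,y)$. Vertical composition: if $h$ has $Uh:S'\times V\to S''\times W$, then $f;h$ has $\mathrm{prv}=S$, $\mathrm{dom}=X\times V$, $\mathrm{nxt}=S''$, $\mathrm{cod}=Y\times W$ and $U(f;h)(s,x,v)=(s'',y,w)$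 where $(s',y)=Uf(s,x)$, $(s'',w)=Uh(s',v)$. For $\phi:X\to Y$ in $\mathbb C$, $\phi^h$ is the 2-cell with underlying morphism $\phi$, $\mathrm{prv}=\mathrm{nxt}=1$, $\mathrm{dom}=X$, $\mathrm{cod}=Y$; $\phi^v$ is the 2-cell with underlying morphism $\phi$, $\mathrm{prv}=X$, $\mathrm{nxt}=Y$, $\mathrm{dom}=\mathrm{cod}=1$. Stateful morphism sequences: for $\mathbf X,\mathbf Y\in|\mathbb C|^{\mathbb N}$, a stateful morphism sequence $(i,\mathbf s):\mathbf X\to\mathbf Y$ is a sequence $\mathbf s$ of 2-cells with $\mathrm{dom}\,\mathbf s_k=\mathbf X_k$, $\mathrm{cod}\,\mathbf s_k=\mathbf Y_k$, $\mathrm{nxt}\,\mathbf s_k=\mathrm{prv}\,\mathbf s_{k+1}$ for all $k$, and a morphism $i:1\to\mathrm{prv}\,\mathbf s_0$. Its $n$th truncation is $\mathrm{Tc}_n(i,\mathbf s)=U(i^v;\mathbf s_0;\cdots;\mathbf s_n;(!_{\mathrm{nxt}\,\mathbf s_n})^v):\prod_{k=0}^n\mathbf X_k\to\prod_{k=0}^n\mathbf Y_k$. Two stateful morphism sequences $\mathbf X\to\mathbf Y$ are extensionally equal if all their truncations agree. $\mathrm{St}(\mathbb C)$ has objects $|\mathbb C|^{\mathbb N}$ and morphisms the extensional equivalence classes of stateful morphism sequences. Identity on $\mathbf X$: $(\mathrm{id}_1,[(\mathrm{id}_{\mathbf X_k})^h]_k)$. Composition of $(j,\mathbf t):\mathbf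 X\to\mathbf Y$ and $(i,\mathbf s):\mathbf Y\to\mathbf Z$: $(i,\mathbf s)\circ(j,\mathbf t)=(\langle j,i\rangle,[\mathbf s_k*\mathbf t_k]_k)$ (well defined on classes). $\mathrm{St}(\mathbb C)$ is Cartesian with terminal object $[1]$, $\mathbf X\times\mathbf Y=[\mathbf X_k\times\mathbf Y_k]_k$ and projections $(\mathrm{id}_1,[\pi_n^h]_k)$. Delayed trace: if a 2-cell $f$ has $\mathrm{prv}\,f=S$, $\mathrm{dom}\,f=T\times X$, $\mathrm{nxt}\,f=S'$, $\mathrm{cod}\,f=T'\times Y$, its value-to-state conversion ${}^{T}\lfloor f\rceil_{T'}$ is the 2-cell with the same underlying morphism but $\mathrm{prv}=S\times T$, $\mathrm{dom}=X$, $\mathrm{nxt}=S'\times T'$, $\mathrm{cod}=Y$. For $(i,\mathbf s):\mathbf T\times\mathbf X\to\bigcirc\mathbf T\times\mathbf Y$ in $\mathrm{St}(\mathbb C)$ and $p:1\to\mathbf T_0$ in $\mathbb C$, the delayed trace is $\mathrm{tr}^{\mathbf T}_p(i,\mathbf s)=(\langle i,p\rangle,[{}^{\mathbf T_k}\lfloor\mathbf s_k\rceil_{\mathbf T_{k+1}}]_k):\mathbf X\to\mathbf Y$ (well defined on classes). -}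

module Defs where

open import Level using (_⊔_) renaming (suc to lsuc)
open import Data.Nat.Base using (ℕ; zero; suc)
open import Relation.Binary.Core using (Rel)
open import Relation.Binary.Structures using (IsEquivalence)
open import Relation.Binary.PropositionalEquality.Core
  using (_≡_; refl; sym; trans; subst₂)

-- Hom-sets are setoids, objects are compared by propositional equality.

record CartesianCategory o ℓ e : Set (lsuc (o ⊔ ℓ ⊔ e)) where
  infix  4 _≈_
  infixr 9 _∘_
  infixr 7 _⊗_
  field
    Obj : Set o
    Hom : Obj → Obj → Set ℓ
    _≈_ : ∀ {A B} → Rel (Hom A B) e

    id  : ∀ {A} → Hom A A
    _∘_ : ∀ {A B C} → Hom B C → Hom A B → Hom A C

    isEquivalence : ∀ {A B} → IsEquivalence (_≈_ {A} {B})
    ∘-resp-≈      : ∀ {A B C} {f f′ : Hom B C} {g g′ : Hom A B} →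
                    f ≈ f′ → g ≈ g′ → f ∘ g ≈ f′ ∘ g′
    identityˡ     : ∀ {A B} {f : Hom A B} → id ∘ f ≈ f
    identityʳ     : ∀ {A B} {f : Hom A B} → f ∘ id ≈ f
    assoc         : ∀ {A B C D} {f : Hom C D} {g : Hom B C} {h : Hom A B} →
                    (f ∘ g) ∘ h ≈ f ∘ (g ∘ h)

    𝟏        : Obj
    !        : ∀ {A} → Hom A 𝟏
    !-unique : ∀ {A} (f : Hom A 𝟏) → ! ≈ f

    _⊗_      : Obj → Obj → Obj
    π₁       : ∀ {A B} → Hom (A ⊗ B) A
    π₂       : ∀ {A B} → Hom (A ⊗ B) B
    ⟨_,_⟩    : ∀ {A B C} → Hom C A → Hom C B → Hom C (A ⊗ B)
    project₁ : ∀ {A B C} {f : Hom C A} {g : Hom C B} → π₁ ∘ ⟨ f , g ⟩ ≈ f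
    project₂ : ∀ {A B C} {f : Hom C A} {g : Hom C B} → π₂ ∘ ⟨ f , g ⟩ ≈ g
    unique   : ∀ {A B C} {f : Hom C A} {g : Hom C B} {h : Hom C (A ⊗ B)} →
               π₁ ∘ h ≈ f → π₂ ∘ h ≈ g → ⟨ f , g ⟩ ≈ h

  -- A morphism seen at propositionally equal source and target.
  cast : ∀ {A A′ B B′} → A ≡ A′ → B ≡ B′ → Hom A B → Hom A′ B′
  cast = subst₂ Hom

-- Strictness: the two sides of each associativity and unit isomorphism are
-- equal objects and, once they are identified, the isomorphism is the identity.

record StrictCartesianCategory o ℓ e : Set (lsuc (o ⊔ ℓ ⊔ e)) where
  field
    cartesianCategory : CartesianCategory o ℓ e
  open CartesianCategory cartesianCategory public
  field
    ⊗-assoc : ∀ A B C → (A ⊗ B) ⊗ C ≡ A ⊗ (B ⊗ C)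
    ⊗-unitˡ : ∀ A → 𝟏 ⊗ A ≡ A
    ⊗-unitʳ : ∀ A → A ⊗ 𝟏 ≡ A

    associator-id : ∀ {A B C} →
      cast (⊗-assoc A B C) refl ⟨ π₁ ∘ π₁ , ⟨ π₂ ∘ π₁ , π₂ ⟩ ⟩ ≈ id
    unitorˡ-id    : ∀ {A} → cast (⊗-unitˡ A) refl π₂ ≈ id
    unitorʳ-id    : ∀ {A} → cast (⊗-unitʳ A) refl π₁ ≈ id

module Stateful {o ℓ e} (ℂ : StrictCartesianCategory o ℓ e) where
  open StrictCartesianCategory ℂ

  -- The indices are, in order, prv, dom, nxt and cod.

  record TwoCell (S X S′ Y : Obj) : Set ℓ where
    constructor cell
    field
      U : Hom (S ⊗ X) (S′ ⊗ Y)
  open TwoCell public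

  infixr 8 _∗_
  infixl 7 _⨾_
  infix  10 _ʰ _ᵛ

  -- Horizontal composition, in the order of composition of functions.

  _∗_ : ∀ {S S′ T T′ X Y Z} →
        TwoCell T Y T′ Z → TwoCell S X S′ Y → TwoCell (S ⊗ T) X (S′ ⊗ T′) Z
  U (_∗_ {S} {T = T} {X = X} g f) = ⟨ ⟨ π₁ ∘ s′y , π₁ ∘ t′z ⟩ , π₂ ∘ t′z ⟩
    where
    s : Hom ((S ⊗ T) ⊗ X) S
    s = π₁ ∘ π₁
    t : Hom ((S ⊗ T) ⊗ X) T
    t = π₂ ∘ π₁
    x : Hom ((S ⊗ T) ⊗ X) X
    x = π₂
    s′y = U f ∘ ⟨ s , x ⟩
    t′z = U g ∘ ⟨ t , π₂ ∘ s′y ⟩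

  -- Vertical composition, in diagrammatic order.

  _⨾_ : ∀ {S S′ S″ X Y V W} →
        TwoCell S X S′ Y → TwoCell S′ V S″ W → TwoCell S (X ⊗ V) S″ (Y ⊗ W)
  U (_⨾_ {S} {X = X} {V = V} f h) = ⟨ π₁ ∘ s″w , ⟨ π₂ ∘ s′y , π₂ ∘ s″w ⟩ ⟩
    where
    s : Hom (S ⊗ (X ⊗ V)) S
    s = π₁
    x : Hom (S ⊗ (X ⊗ V)) X
    x = π₁ ∘ π₂
    v : Hom (S ⊗ (X ⊗ V)) V
    v = π₂ ∘ π₂
    s′y = U f ∘ ⟨ s , x ⟩
    s″w = U h ∘ ⟨ π₁ ∘ s′y , v ⟩

  _ʰ : ∀ {X Y} → Hom X Y → TwoCell 𝟏 X 𝟏 Y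
  U (_ʰ {X} {Y} φ) = cast (sym (⊗-unitˡ X)) (sym (⊗-unitˡ Y)) φ

  _ᵛ : ∀ {X Y} → Hom X Y → TwoCell X 𝟏 Y 𝟏
  U (_ᵛ {X} {Y} φ) = cast (sym (⊗-unitʳ X)) (sym (⊗-unitʳ Y)) φ

  -- Value-to-state conversion keeps the underlying morphism: by strictness only
  -- the bracketing of its source and target changes.

  ⌊_⌉ : ∀ {S S′ T T′ X Y} →
        TwoCell S (T ⊗ X) S′ (T′ ⊗ Y) → TwoCell (S ⊗ T) X (S′ ⊗ T′) Y
  U (⌊_⌉ {S} {S′} {T} {T′} {X} {Y} f) =
    cast (sym (⊗-assoc S T X)) (sym (⊗-assoc S′ T′ Y)) (U f)

  Objs : Set o
  Objs = ℕ → Obj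

  ◯ : Objs → Objs
  ◯ X k = X (suc k)

  -- nxt 𝐬ₖ = prv 𝐬ₖ₊₁ holds by construction: both are the object state (suc k).

  record Seq (X Y : Objs) : Set (o ⊔ ℓ) where
    field
      state : Objs
      init  : Hom 𝟏 (state 0)
      step  : ∀ k → TwoCell (state k) (X k) (state (suc k)) (Y k)
  open Seq public

  -- ∏< n X is the product of the Xₖ with k < n.

  ∏< : ℕ → Objs → Obj
  ∏< zero    X = 𝟏
  ∏< (suc n) X = ∏< n X ⊗ X n

  -- run n s is the vertical composite iᵛ ⨾ 𝐬₀ ⨾ ⋯ ⨾ 𝐬ₙ₋₁; its dom and cod carry a
  -- leading factor 𝟏, the empty product, coming from iᵛ.

  run : ∀ {X Y} n (s : Seq X Y) → TwoCell 𝟏 (∏< n X) (state s n) (∏< n Y)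
  run zero    s = init s ᵛ
  run (suc n) s = run n s ⨾ step s n

  Tc : ∀ {X Y} n → Seq X Y → Hom (∏< (suc n) X) (∏< (suc n) Y)
  Tc {X} {Y} n s = cast (strip (∏< (suc n) X)) (strip (∏< (suc n) Y))
                        (U (run (suc n) s ⨾ ! ᵛ))
    where
    strip : ∀ P → 𝟏 ⊗ (P ⊗ 𝟏) ≡ P
    strip P = trans (⊗-unitˡ (P ⊗ 𝟏)) (⊗-unitʳ P)

  -- A morphism of St(ℂ) is an element of Seq X Y up to extensional equality.

  infix 4 _≈ˢ_

  _≈ˢ_ : ∀ {X Y} → Rel (Seq X Y) e
  s ≈ˢ t = ∀ n → Tc n s ≈ Tc n t

  infixr 9 _∘ˢ_
  infixr 7 _⊗ˢ_ _⊗₁_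

  idˢ : ∀ {X} → Seq X X
  state idˢ k = 𝟏
  init  idˢ   = id
  step  idˢ k = id ʰ

  _∘ˢ_ : ∀ {X Y Z} → Seq Y Z → Seq X Y → Seq X Z
  state (s ∘ˢ t) k = state t k ⊗ state s k
  init  (s ∘ˢ t)   = ⟨ init t , init s ⟩
  step  (s ∘ˢ t) k = step s k ∗ step t k

  𝟏ˢ : Objs
  𝟏ˢ k = 𝟏

  _⊗ˢ_ : Objs → Objs → Objs
  (X ⊗ˢ Y) k = X k ⊗ Y k

  π₁ˢ : ∀ {X Y} → Seq (X ⊗ˢ Y) X
  state π₁ˢ k = 𝟏
  init  π₁ˢ   = id
  step  π₁ˢ k = π₁ ʰ

  π₂ˢ : ∀ {X Y} → Seq (X ⊗ˢ Y) Y
  state π₂ˢ k = 𝟏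
  init  π₂ˢ   = id
  step  π₂ˢ k = π₂ ʰ

  -- The pairing for these projections runs both components on the same input:
  -- (s , t , x) ↦ (s′ , t′ , y , z), where (s′ , y) = f (s , x) and
  -- (t′ , z) = g (t , x).

  ⟨_,_⟩ᶜ : ∀ {S S′ T T′ X Y Z} → TwoCell S X S′ Y → TwoCell T X T′ Z →
           TwoCell (S ⊗ T) X (S′ ⊗ T′) (Y ⊗ Z)
  U (⟨_,_⟩ᶜ {S} {T = T} {X = X} f g) =
      ⟨ ⟨ π₁ ∘ s′y , π₁ ∘ t′z ⟩ , ⟨ π₂ ∘ s′y , π₂ ∘ t′z ⟩ ⟩
    where
    s : Hom ((S ⊗ T) ⊗ X) S
    s = π₁ ∘ π₁
    t : Hom ((S ⊗ T) ⊗ X) T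
    t = π₂ ∘ π₁
    x : Hom ((S ⊗ T) ⊗ X) X
    x = π₂
    s′y = U f ∘ ⟨ s , x ⟩
    t′z = U g ∘ ⟨ t , x ⟩

  ⟨_,_⟩ˢ : ∀ {X Y Z} → Seq X Y → Seq X Z → Seq X (Y ⊗ˢ Z)
  state ⟨ s , t ⟩ˢ k = state s k ⊗ state t k
  init  ⟨ s , t ⟩ˢ   = ⟨ init s , init t ⟩
  step  ⟨ s , t ⟩ˢ k = ⟨ step s k , step t k ⟩ᶜ

  _⊗₁_ : ∀ {X X′ Y Y′} → Seq X Y → Seq X′ Y′ → Seq (X ⊗ˢ X′) (Y ⊗ˢ Y′)
  s ⊗₁ t = ⟨ s ∘ˢ π₁ˢ , t ∘ˢ π₂ˢ ⟩ˢ

  tr : ∀ (T : Objs) {X Y} → Hom 𝟏 (T 0) → Seq (T ⊗ˢ X) (◯ T ⊗ˢ Y) → Seq X Y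
  state (tr T p s) k = state s k ⊗ T k
  init  (tr T p s)   = ⟨ init s , p ⟩
  step  (tr T p s) k = ⌊ step s k ⌉

  -- Strictness makes e.g. (X ⊗ˢ Y) ⊗ˢ Z and X ⊗ˢ (Y ⊗ˢ Z) entrywise equal;
  -- castˢ reads a morphism of St(ℂ) along such equalities.

  castˢ : ∀ {X X′ Y Y′} → (∀ k → X k ≡ X′ k) → (∀ k → Y k ≡ Y′ k) →
          Seq X Y → Seq X′ Y′
  state (castˢ p q s)   = state s
  init  (castˢ p q s)   = init s
  step  (castˢ p q s) k =
    subst₂ (λ A B → TwoCell (state s k) A (state s (suc k)) B) (p k) (q k) (step s k)

  assocˢ : ∀ (X Y Z : Objs) k → ((X ⊗ˢ Y) ⊗ˢ Z) k ≡ (X ⊗ˢ (Y ⊗ˢ Z)) k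
  assocˢ X Y Z k = ⊗-assoc (X k) (Y k) (Z k)

  unitˡˢ : ∀ (X : Objs) k → (𝟏ˢ ⊗ˢ X) k ≡ X k
  unitˡˢ X k = ⊗-unitˡ (X k)

{-# OPTIONS --safe #-}

-- The equations of St(ℂ) are checked as on paper, on generalized elements:
-- f [ a , x ]↦[ a′ , y ] says that Uf (a , x) = (a′ , y). Both sides of each
-- equation carry the same state components, differently arranged and padded with
-- components in 𝟏, and update them in the same way. So both realise one machine
-- on tuples of generalized elements, and hence have the same truncations.

module Submission where

open import Defs
open import Level using (_⊔_) renaming (suc to lsuc)
open import Data.Nat.Base using (ℕ; zero; suc)
open import Data.Product.Base using (_×_; _,_)
open import Relation.Binary.Structures using (IsEquivalence)
open import Relation.Binary.PropositionalEquality.Core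
  using (_≡_; refl; sym; subst; subst₂)

module GeneralizedElements {o ℓ e} (ℂ : StrictCartesianCategory o ℓ e) where
  open StrictCartesianCategory ℂ
  open Stateful ℂ
  private module ≈ {A B} = IsEquivalence (isEquivalence {A} {B})

  -- Pairs of generalized elements.

  !-unique₂ : ∀ {Z} {u v : Hom Z 𝟏} → u ≈ v
  !-unique₂ = ≈.trans (≈.sym (!-unique _)) (!-unique _)

  ∘-congˡ : ∀ {A B C} {f : Hom B C} {g h : Hom A B} → g ≈ h → f ∘ g ≈ f ∘ h
  ∘-congˡ = ∘-resp-≈ ≈.refl

  ∘-congʳ : ∀ {A B C} {f g : Hom B C} {h : Hom A B} → f ≈ g → f ∘ h ≈ g ∘ h
  ∘-congʳ f≈g = ∘-resp-≈ f≈g ≈.refl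

  ⟨⟩-cong : ∀ {Z A B} {a a′ : Hom Z A} {b b′ : Hom Z B} →
            a ≈ a′ → b ≈ b′ → ⟨ a , b ⟩ ≈ ⟨ a′ , b′ ⟩
  ⟨⟩-cong a≈a′ b≈b′ = ≈.sym
    (unique (≈.trans project₁ a≈a′) (≈.trans project₂ b≈b′))

  ⟨⟩-η : ∀ {Z A B} {h : Hom Z (A ⊗ B)} → h ≈ ⟨ π₁ ∘ h , π₂ ∘ h ⟩
  ⟨⟩-η = ≈.sym (unique ≈.refl ≈.refl)

  ⟨⟩-∘ : ∀ {Z W A B} {f : Hom W A} {g : Hom W B} {w : Hom Z W} {a b} →
         f ∘ w ≈ a → g ∘ w ≈ b → ⟨ f , g ⟩ ∘ w ≈ ⟨ a , b ⟩
  ⟨⟩-∘ fw≈a gw≈b = ≈.sym (unique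
    (≈.trans (≈.sym assoc) (≈.trans (∘-congʳ project₁) fw≈a))
    (≈.trans (≈.sym assoc) (≈.trans (∘-congʳ project₂) gw≈b)))

  π₁-∘ : ∀ {Z W A B} {h : Hom W (A ⊗ B)} {w : Hom Z W} {a b} →
         h ∘ w ≈ ⟨ a , b ⟩ → (π₁ ∘ h) ∘ w ≈ a
  π₁-∘ hw≈ab = ≈.trans assoc (≈.trans (∘-congˡ hw≈ab) project₁)

  π₂-∘ : ∀ {Z W A B} {h : Hom W (A ⊗ B)} {w : Hom Z W} {a b} →
         h ∘ w ≈ ⟨ a , b ⟩ → (π₂ ∘ h) ∘ w ≈ b
  π₂-∘ hw≈ab = ≈.trans assoc (≈.trans (∘-congˡ hw≈ab) project₂)

  -- Elements of propositionally equal objects.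

  infix 4 _≈[_]_

  -- Strictness identifies objects only propositionally, so the elements to be compared live in
  -- different hom-sets and one must be transported.
  _≈[_]_ : ∀ {Z A B} → Hom Z A → A ≡ B → Hom Z B → Set e
  _≈[_]_ {Z} a p b = subst (Hom Z) p a ≈ b

  ≈[]-sym : ∀ {Z A B} (p : A ≡ B) {a : Hom Z A} {b : Hom Z B} →
            a ≈[ p ] b → b ≈[ sym p ] a
  ≈[]-sym refl = ≈.sym

  -- Turns the strictness axioms into rules on elements. With `p` a variable, matching on `refl`
  -- makes `h` itself the identity; `⊗-assoc A B C` could not be matched this way.
  ≈[]-of-cast : ∀ {Z A B} (p : A ≡ B) {h : Hom A B} {a : Hom Z A} {b : Hom Z B} →
                cast p refl h ≈ id → h ∘ a ≈ b → a ≈[ p ] b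
  ≈[]-of-cast refl h≈id ha≈b =
    ≈.trans (≈.sym (≈.trans (∘-congʳ h≈id) identityˡ)) ha≈b

  ⊗-assoc-≈ : ∀ {Z A B C} {a : Hom Z A} {b : Hom Z B} {c : Hom Z C} →
              ⟨ ⟨ a , b ⟩ , c ⟩ ≈[ ⊗-assoc A B C ] ⟨ a , ⟨ b , c ⟩ ⟩
  ⊗-assoc-≈ = ≈[]-of-cast _ associator-id
    (⟨⟩-∘ (π₁-∘ project₁) (⟨⟩-∘ (π₂-∘ project₁) project₂))

  ⊗-unitˡ-≈ : ∀ {Z A} {u : Hom Z 𝟏} {a : Hom Z A} → ⟨ u , a ⟩ ≈[ ⊗-unitˡ A ] a
  ⊗-unitˡ-≈ = ≈[]-of-cast _ unitorˡ-id project₂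

  ⊗-unitʳ-≈ : ∀ {Z A} {u : Hom Z 𝟏} {a : Hom Z A} → ⟨ a , u ⟩ ≈[ ⊗-unitʳ A ] a
  ⊗-unitʳ-≈ = ≈[]-of-cast _ unitorʳ-id project₁

  cast-∘ : ∀ {Z A A′ B B′} (p : A ≡ A′) (q : B ≡ B′) {f : Hom A B}
           {a : Hom Z A} {a′ : Hom Z A′} {b : Hom Z B} {b′ : Hom Z B′} →
           a ≈[ p ] a′ → b ≈[ q ] b′ → f ∘ a ≈ b → cast p q f ∘ a′ ≈ b′
  cast-∘ refl refl a≈a′ b≈b′ fa≈b =
    ≈.trans (∘-congˡ (≈.sym a≈a′)) (≈.trans fa≈b b≈b′)

  cast-resp-≈ : ∀ {A A′ B B′} (p : A ≡ A′) (q : B ≡ B′) {f g : Hom A B} →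
                f ≈ g → cast p q f ≈ cast p q g
  cast-resp-≈ refl refl f≈g = f≈g

  -- Evaluation of 2-cells.

  infix 4 _[_,_]↦[_,_]

  -- A record rather than a synonym for its field: `U` of a composite cell unfolds, and the wrapper
  -- keeps the cell and the four elements inferable by unification.
  record _[_,_]↦[_,_] {Z S X S′ Y} (f : TwoCell S X S′ Y)
           (a : Hom Z S) (x : Hom Z X) (a′ : Hom Z S′) (y : Hom Z Y) : Set e where
    constructor evaluates
    field
      eval : U f ∘ ⟨ a , x ⟩ ≈ ⟨ a′ , y ⟩
  open _[_,_]↦[_,_]

  nextState : ∀ {Z S X S′ Y} → TwoCell S X S′ Y → Hom Z S → Hom Z X → Hom Z S′
  nextState f a x = π₁ ∘ (U f ∘ ⟨ a , x ⟩)

  output : ∀ {Z S X S′ Y} → TwoCell S X S′ Y → Hom Z S → Hom Z X → Hom Z Y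
  output f a x = π₂ ∘ (U f ∘ ⟨ a , x ⟩)

  ↦-total : ∀ {Z S X S′ Y} (f : TwoCell S X S′ Y) {a : Hom Z S} {x : Hom Z X} →
            f [ a , x ]↦[ nextState f a x , output f a x ]
  ↦-total f = evaluates ⟨⟩-η

  ↦-resp : ∀ {Z S X S′ Y} {f : TwoCell S X S′ Y}
           {a : Hom Z S} {x w : Hom Z X} {a′ : Hom Z S′} {y z : Hom Z Y} →
           x ≈ w → y ≈ z → f [ a , x ]↦[ a′ , y ] → f [ a , w ]↦[ a′ , z ]
  ↦-resp x≈w y≈z f↦ = evaluates
    (≈.trans (∘-congˡ (⟨⟩-cong ≈.refl (≈.sym x≈w)))
             (≈.trans (eval f↦) (⟨⟩-cong ≈.refl y≈z)))

  -- Tracing needs the output as an explicit pair, since its first half becomes part of the state.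
  ↦-total₂ : ∀ {Z S X S′ Y₁ Y₂} (f : TwoCell S X S′ (Y₁ ⊗ Y₂))
             {a : Hom Z S} {x : Hom Z X} →
             f [ a , x ]↦[ nextState f a x ,
                           ⟨ π₁ ∘ output f a x , π₂ ∘ output f a x ⟩ ]
  ↦-total₂ f = ↦-resp ≈.refl ⟨⟩-η (↦-total f)

  -- Each intermediate result inside a composite cell has this form; the rules for `_∗_`, `_⨾_` and
  -- `⟨_,_⟩ᶜ` evaluate them one by one.
  ↦-∘ : ∀ {Z W S X S′ Y} {f : TwoCell S X S′ Y} {s : Hom W S} {v : Hom W X}
        {w : Hom Z W} {a x a′ y} →
        s ∘ w ≈ a → v ∘ w ≈ x → f [ a , x ]↦[ a′ , y ] →
        (U f ∘ ⟨ s , v ⟩) ∘ w ≈ ⟨ a′ , y ⟩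
  ↦-∘ sw≈a vw≈x f↦ = ≈.trans assoc (≈.trans (∘-congˡ (⟨⟩-∘ sw≈a vw≈x)) (eval f↦))

  ∗-↦ : ∀ {Z S S′ T T′ X Y V} {g : TwoCell T Y T′ V} {f : TwoCell S X S′ Y}
        {a : Hom Z S} {b : Hom Z T} {x a′ y b′ z} →
        f [ a , x ]↦[ a′ , y ] → g [ b , y ]↦[ b′ , z ] →
        (g ∗ f) [ ⟨ a , b ⟩ , x ]↦[ ⟨ a′ , b′ ⟩ , z ]
  ∗-↦ f↦ g↦ = evaluates (⟨⟩-∘ (⟨⟩-∘ (π₁-∘ s′y) (π₁-∘ t′z)) (π₂-∘ t′z))
    where
    s′y = ↦-∘ (π₁-∘ project₁) project₂ f↦
    t′z = ↦-∘ (π₂-∘ project₁) (π₂-∘ s′y) g↦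

  ⨾-↦ : ∀ {Z S S′ S″ X Y V W} {f : TwoCell S X S′ Y} {h : TwoCell S′ V S″ W}
        {a : Hom Z S} {x v a′ y a″ w} →
        f [ a , x ]↦[ a′ , y ] → h [ a′ , v ]↦[ a″ , w ] →
        (f ⨾ h) [ a , ⟨ x , v ⟩ ]↦[ a″ , ⟨ y , w ⟩ ]
  ⨾-↦ f↦ h↦ = evaluates (⟨⟩-∘ (π₁-∘ s″w) (⟨⟩-∘ (π₂-∘ s′y) (π₂-∘ s″w)))
    where
    s′y = ↦-∘ project₁ (π₁-∘ project₂) f↦
    s″w = ↦-∘ (π₁-∘ s′y) (π₂-∘ project₂) h↦

  ⟨⟩ᶜ-↦ : ∀ {Z S S′ T T′ X Y V} {f : TwoCell S X S′ Y} {g : TwoCell T X T′ V}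
          {a : Hom Z S} {b : Hom Z T} {x a′ y b′ z} →
          f [ a , x ]↦[ a′ , y ] → g [ b , x ]↦[ b′ , z ] →
          ⟨ f , g ⟩ᶜ [ ⟨ a , b ⟩ , x ]↦[ ⟨ a′ , b′ ⟩ , ⟨ y , z ⟩ ]
  ⟨⟩ᶜ-↦ f↦ g↦ = evaluates
    (⟨⟩-∘ (⟨⟩-∘ (π₁-∘ s′y) (π₁-∘ t′z)) (⟨⟩-∘ (π₂-∘ s′y) (π₂-∘ t′z)))
    where
    s′y = ↦-∘ (π₁-∘ project₁) project₂ f↦
    t′z = ↦-∘ (π₂-∘ project₁) project₂ g↦

  -- The elements `u` and `v` are free: any element of `𝟏` may stand for the trivial state, so
  -- realisations can pad with `!`.
  ʰ-↦ : ∀ {Z X Y} {φ : Hom X Y} {x : Hom Z X} {y : Hom Z Y} {u v : Hom Z 𝟏} →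
        φ ∘ x ≈ y → (φ ʰ) [ u , x ]↦[ v , y ]
  ʰ-↦ φx≈y = evaluates (cast-∘ (sym (⊗-unitˡ _)) (sym (⊗-unitˡ _))
    (≈[]-sym (⊗-unitˡ _) ⊗-unitˡ-≈) (≈[]-sym (⊗-unitˡ _) ⊗-unitˡ-≈) φx≈y)

  ᵛ-↦ : ∀ {Z X Y} {φ : Hom X Y} {x : Hom Z X} {y : Hom Z Y} {u v : Hom Z 𝟏} →
        φ ∘ x ≈ y → (φ ᵛ) [ x , u ]↦[ y , v ]
  ᵛ-↦ φx≈y = evaluates (cast-∘ (sym (⊗-unitʳ _)) (sym (⊗-unitʳ _))
    (≈[]-sym (⊗-unitʳ _) ⊗-unitʳ-≈) (≈[]-sym (⊗-unitʳ _) ⊗-unitʳ-≈) φx≈y)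

  -- Only brackets move: by strictness the two nestings are the same element, at the source and at
  -- the target, so the evaluation of `f` carries over.
  ⌊⌉-↦ : ∀ {Z S S′ T T′ X Y} {f : TwoCell S (T ⊗ X) S′ (T′ ⊗ Y)}
         {a : Hom Z S} {t : Hom Z T} {x a′ t′ y} →
         f [ a , ⟨ t , x ⟩ ]↦[ a′ , ⟨ t′ , y ⟩ ] →
         ⌊ f ⌉ [ ⟨ a , t ⟩ , x ]↦[ ⟨ a′ , t′ ⟩ , y ]
  ⌊⌉-↦ f↦ = evaluates (cast-∘ (sym (⊗-assoc _ _ _)) (sym (⊗-assoc _ _ _))
    (≈[]-sym (⊗-assoc _ _ _) ⊗-assoc-≈) (≈[]-sym (⊗-assoc _ _ _) ⊗-assoc-≈)
    (eval f↦))

  subst₂-↦ : ∀ {Z S S′ X X′ Y Y′} (p : X ≡ X′) (q : Y ≡ Y′)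
             {f : TwoCell S X S′ Y} {a : Hom Z S} {a′ : Hom Z S′}
             {x : Hom Z X} {x′ : Hom Z X′} {y : Hom Z Y} {y′ : Hom Z Y′} →
             x ≈[ p ] x′ → y ≈[ q ] y′ → f [ a , x ]↦[ a′ , y ] →
             subst₂ (λ A B → TwoCell S A S′ B) p q f [ a , x′ ]↦[ a′ , y′ ]
  subst₂-↦ refl refl = ↦-resp

  -- The primed and unprimed `u` and `v` are the trivial states of the two projections, each of
  -- which hands one factor of the input to its component.
  ⊗₁-↦ : ∀ {X X′ Y Y′} (s : Seq X Y) (t : Seq X′ Y′) {k Z}
         {a : Hom Z (state s k)} {b : Hom Z (state t k)} {x x′ y y′ a′ b′}
         {u u′ v v′ : Hom Z 𝟏} →
         step s k [ a , x ]↦[ a′ , y ] → step t k [ b , x′ ]↦[ b′ , y′ ] →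
         step (s ⊗₁ t) k [ ⟨ ⟨ u , a ⟩ , ⟨ v , b ⟩ ⟩ , ⟨ x , x′ ⟩ ]↦[
                           ⟨ ⟨ u′ , a′ ⟩ , ⟨ v′ , b′ ⟩ ⟩ , ⟨ y , y′ ⟩ ]
  ⊗₁-↦ s t s↦ t↦ = ⟨⟩ᶜ-↦ (∗-↦ (ʰ-↦ project₁) s↦) (∗-↦ (ʰ-↦ project₂) t↦)

  ⊗₁-init : ∀ {X X′ Y Y′} (s : Seq X Y) (t : Seq X′ Y′) {Z}
            {u v : Hom Z 𝟏} →
            init (s ⊗₁ t) ∘ ! ≈ ⟨ ⟨ u , init s ∘ ! ⟩ , ⟨ v , init t ∘ ! ⟩ ⟩
  ⊗₁-init s t = ⟨⟩-∘ (⟨⟩-∘ !-unique₂ ≈.refl) (⟨⟩-∘ !-unique₂ ≈.refl)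

  -- Machines and truncations.

  record Machine (X Y : Objs) : Set (o ⊔ lsuc ℓ) where
    field
      Config : Obj → ℕ → Set ℓ
      start  : ∀ {Z} → Config Z 0
      next   : ∀ {Z} k → Config Z k → Hom Z (X k) → Config Z (suc k)
      out    : ∀ {Z} k → Config Z k → Hom Z (X k) → Hom Z (Y k)

    config : ∀ {Z} n → Hom Z (∏< n X) → Config Z n
    config zero    x = start
    config (suc n) x = next n (config n (π₁ ∘ x)) (π₂ ∘ x)

    outs : ∀ {Z} n → Hom Z (∏< n X) → Hom Z (∏< n Y)
    outs zero    x = !
    outs (suc n) x = ⟨ outs n (π₁ ∘ x) , out n (config n (π₁ ∘ x)) (π₂ ∘ x) ⟩

  -- A simulation: `⟦_⟧` lays a configuration out as a state of `s`. Only this layout depends on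
  -- `s`; the outputs are those of `M`.
  record Realises {X Y} (s : Seq X Y) (M : Machine X Y) : Set (o ⊔ ℓ ⊔ e) where
    open Machine M
    field
      ⟦_⟧    : ∀ {Z k} → Config Z k → Hom Z (state s k)
      init-≈ : ∀ {Z} → init s ∘ ! ≈ ⟦ start {Z} ⟧
      step-↦ : ∀ {Z k} (c : Config Z k) (x : Hom Z (X k)) →
               step s k [ ⟦ c ⟧ , x ]↦[ ⟦ next k c x ⟧ , out k c x ]

    run-↦ : ∀ {Z} n (x : Hom Z (∏< n X)) →
            run n s [ ! , x ]↦[ ⟦ config n x ⟧ , outs n x ]
    run-↦ zero    x = ᵛ-↦ init-≈
    -- `⨾-↦` accepts only explicit pairs, so `x` is split into the earlier inputs and the last one.
    run-↦ (suc n) x = ↦-resp (≈.sym ⟨⟩-η) ≈.refl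
                        (⨾-↦ (run-↦ n (π₁ ∘ x)) (step-↦ _ (π₂ ∘ x)))

    -- Evaluation at the generic element, the identity of the source, determines the morphism. The
    -- final `!` discards the state, so what remains depends on `M` alone.
    run-!-≈ : ∀ n → U (run n s ⨾ ! ᵛ) ≈ ⟨ ! , ⟨ outs n (π₁ ∘ π₂) , ! ⟩ ⟩
    run-!-≈ n =
      ≈.trans (≈.sym identityʳ)
      (≈.trans (∘-congˡ (≈.sym (unique !-unique₂ (≈.trans identityʳ ⟨⟩-η))))
      (eval (⨾-↦ (run-↦ n _) (ᵛ-↦ !-unique₂))))

  realises⇒≈ˢ : ∀ {X Y} {s t : Seq X Y} (M : Machine X Y) →
                Realises s M → Realises t M → s ≈ˢ t
  realises⇒≈ˢ M s⊨M t⊨M n = cast-resp-≈ _ _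
    -- `Tc n` runs the steps 0 to `n`, hence the index `suc n`.
    (≈.trans (Realises.run-!-≈ s⊨M (suc n)) (≈.sym (Realises.run-!-≈ t⊨M (suc n))))

  -- Naturality in target and source.

  module _ {T X Y Z : Objs} (q : Hom 𝟏 (T 0))
           (s : Seq (T ⊗ˢ X) (◯ T ⊗ˢ Y)) (r : Seq Y Z) where

    targetMachine : Machine X Z
    targetMachine = record
      { Config = λ A k → Hom A (state s k) × Hom A (T k) × Hom A (state r k)
      ; start  = init s ∘ ! , q ∘ ! , init r ∘ !
      ; next   = λ k (a , t , b) x → let y = output (step s k) a ⟨ t , x ⟩ in
                 nextState (step s k) a ⟨ t , x ⟩ , π₁ ∘ y ,
                 nextState (step r k) b (π₂ ∘ y)
      ; out    = λ k (a , t , b) x →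
                 output (step r k) b (π₂ ∘ output (step s k) a ⟨ t , x ⟩)
      }

    target-naturality : r ∘ˢ tr T q s ≈ˢ tr T q ((idˢ ⊗₁ r) ∘ˢ s)
    target-naturality = realises⇒≈ˢ targetMachine
      record
        { ⟦_⟧    = λ (a , t , b) → ⟨ ⟨ a , t ⟩ , b ⟩
        ; init-≈ = ⟨⟩-∘ (⟨⟩-∘ ≈.refl ≈.refl) ≈.refl
        ; step-↦ = λ {_} {k} _ _ →
                     ∗-↦ (⌊⌉-↦ (↦-total₂ (step s k))) (↦-total (step r k))
        }
      record
        -- In the state of `idˢ ⊗₁ r`, the first `!` of each inner pair belongs to a projection and
        -- the remaining one to `idˢ`; the trace appends `t` last.
        { ⟦_⟧    = λ (a , t , b) → ⟨ ⟨ a , ⟨ ⟨ ! , ! ⟩ , ⟨ ! , b ⟩ ⟩ ⟩ , t ⟩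
        ; init-≈ = ⟨⟩-∘ (⟨⟩-∘ ≈.refl (≈.trans (⊗₁-init (idˢ {◯ T}) r)
                     (⟨⟩-cong (⟨⟩-cong ≈.refl !-unique₂) ≈.refl))) ≈.refl
        ; step-↦ = λ {_} {k} _ _ → ⌊⌉-↦ (∗-↦ (↦-total₂ (step s k))
                     (⊗₁-↦ (idˢ {◯ T}) r (ʰ-↦ identityˡ) (↦-total (step r k))))
        }

  module _ {T W X Y : Objs} (q : Hom 𝟏 (T 0))
           (s : Seq (T ⊗ˢ X) (◯ T ⊗ˢ Y)) (t : Seq W X) where

    sourceMachine : Machine W Y
    sourceMachine = record
      { Config = λ A k → Hom A (state t k) × Hom A (state s k) × Hom A (T k)
      ; start  = init t ∘ ! , init s ∘ ! , q ∘ !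
      ; next   = λ k (b , a , c) w → let x = output (step t k) b w in
                 nextState (step t k) b w ,
                 nextState (step s k) a ⟨ c , x ⟩ ,
                 π₁ ∘ output (step s k) a ⟨ c , x ⟩
      ; out    = λ k (b , a , c) w →
                 π₂ ∘ output (step s k) a ⟨ c , output (step t k) b w ⟩
      }

    source-naturality : tr T q s ∘ˢ t ≈ˢ tr T q (s ∘ˢ (idˢ ⊗₁ t))
    source-naturality = realises⇒≈ˢ sourceMachine
      record
        { ⟦_⟧    = λ (b , a , c) → ⟨ b , ⟨ a , c ⟩ ⟩
        ; init-≈ = ⟨⟩-∘ ≈.refl (⟨⟩-∘ ≈.refl ≈.refl)
        ; step-↦ = λ {_} {k} _ _ →
                     ∗-↦ (↦-total (step t k)) (⌊⌉-↦ (↦-total₂ (step s k)))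
        }
      record
        -- `idˢ ⊗₁ t` runs before `s`, so its padded state comes first; the feedback value `c` again
        -- comes last.
        { ⟦_⟧    = λ (b , a , c) → ⟨ ⟨ ⟨ ⟨ ! , ! ⟩ , ⟨ ! , b ⟩ ⟩ , a ⟩ , c ⟩
        ; init-≈ = ⟨⟩-∘ (⟨⟩-∘ (≈.trans (⊗₁-init (idˢ {T}) t)
                     (⟨⟩-cong (⟨⟩-cong ≈.refl !-unique₂) ≈.refl)) ≈.refl) ≈.refl
        ; step-↦ = λ {_} {k} _ _ → ⌊⌉-↦ (∗-↦
                     (⊗₁-↦ (idˢ {T}) t (ʰ-↦ identityˡ) (↦-total (step t k)))
                     (↦-total₂ (step s k)))
        }

  -- Superposing.

  module _ {T W X Y Z : Objs} (q : Hom 𝟏 (T 0))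
           (s : Seq (T ⊗ˢ X) (◯ T ⊗ˢ Y)) (p : Seq W Z) where

    superposingMachine : Machine (X ⊗ˢ W) (Y ⊗ˢ Z)
    superposingMachine = record
      { Config = λ A k → Hom A (state s k) × Hom A (T k) × Hom A (state p k)
      ; start  = init s ∘ ! , q ∘ ! , init p ∘ !
      ; next   = λ k (a , t , b) x →
                 nextState (step s k) a ⟨ t , π₁ ∘ x ⟩ ,
                 π₁ ∘ output (step s k) a ⟨ t , π₁ ∘ x ⟩ ,
                 nextState (step p k) b (π₂ ∘ x)
      ; out    = λ k (a , t , b) x →
                 ⟨ π₂ ∘ output (step s k) a ⟨ t , π₁ ∘ x ⟩ ,
                   output (step p k) b (π₂ ∘ x) ⟩
      }

    superposing : tr T q s ⊗₁ p ≈ˢ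
                  tr T q (castˢ (assocˢ T X W) (assocˢ (◯ T) Y Z) (s ⊗₁ p))
    superposing = realises⇒≈ˢ superposingMachine
      record
        { ⟦_⟧    = λ (a , t , b) → ⟨ ⟨ ! , ⟨ a , t ⟩ ⟩ , ⟨ ! , b ⟩ ⟩
        ; init-≈ = ≈.trans (⊗₁-init (tr T q s) p)
                     (⟨⟩-cong (⟨⟩-cong ≈.refl (⟨⟩-∘ ≈.refl ≈.refl)) ≈.refl)
        ; step-↦ = λ {_} {k} _ _ → ↦-resp (≈.sym ⟨⟩-η) ≈.refl
                     (⊗₁-↦ (tr T q s) p (⌊⌉-↦ (↦-total₂ (step s k)))
                                        (↦-total (step p k)))
        }
      record
        -- Tracing after the product puts `t` behind the states of both factors, whereas tracing
        -- first keeps it next to `a`.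
        { ⟦_⟧    = λ (a , t , b) → ⟨ ⟨ ⟨ ! , a ⟩ , ⟨ ! , b ⟩ ⟩ , t ⟩
        ; init-≈ = ⟨⟩-∘ (⊗₁-init s p) ≈.refl
        ; step-↦ = λ {_} {k} _ _ → ↦-resp (≈.sym ⟨⟩-η) ≈.refl
                     -- `castˢ` regroups so that the feedback factor leads, as the trace requires.
                     (⌊⌉-↦ (subst₂-↦ _ _ ⊗-assoc-≈ ⊗-assoc-≈
                       (⊗₁-↦ s p (↦-total₂ (step s k)) (↦-total (step p k)))))
        }

  -- Vanishing.

  module _ {X Y : Objs} (s : Seq (𝟏ˢ ⊗ˢ X) (◯ 𝟏ˢ ⊗ˢ Y)) where

    vanishing₁Machine : Machine X Y
    vanishing₁Machine = record
      { Config = λ A k → Hom A (state s k)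
      ; start  = init s ∘ !
      ; next   = λ k a x → nextState (step s k) a ⟨ ! , x ⟩
      ; out    = λ k a x → π₂ ∘ output (step s k) a ⟨ ! , x ⟩
      }

    vanishing₁ : tr 𝟏ˢ id s ≈ˢ castˢ (unitˡˢ X) (unitˡˢ Y) s
    vanishing₁ = realises⇒≈ˢ vanishing₁Machine
      record
        { ⟦_⟧    = λ a → ⟨ a , ! ⟩
        ; init-≈ = ⟨⟩-∘ ≈.refl !-unique₂
        -- The value fed back is an element of `𝟏`, hence equal to the `!` kept in the state.
        ; step-↦ = λ {_} {k} _ _ → ⌊⌉-↦ (↦-resp ≈.refl (⟨⟩-cong !-unique₂ ≈.refl)
                                         (↦-total₂ (step s k)))
        }
      record
        { ⟦_⟧    = λ a → a
        ; init-≈ = ≈.refl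
        ; step-↦ = λ {_} {k} _ _ →
                     -- Up to the unit law, the bare `x` is the same element as `⟨ ! , x ⟩`, on
                     -- which the machine runs `s`.
                     subst₂-↦ _ _ ⊗-unitˡ-≈ ⊗-unitˡ-≈ (↦-total₂ (step s k))
        }

  module _ {P Q X Y : Objs} (p : Hom 𝟏 (P 0)) (q : Hom 𝟏 (Q 0))
           (s : Seq (P ⊗ˢ (Q ⊗ˢ X)) (◯ P ⊗ˢ (◯ Q ⊗ˢ Y))) where

    vanishing⊗Machine : Machine X Y
    vanishing⊗Machine = record
      { Config = λ A k → Hom A (state s k) × Hom A (P k) × Hom A (Q k)
      ; start  = init s ∘ ! , p ∘ ! , q ∘ !
      ; next   = λ k (a , b , c) x →
                 let y = output (step s k) a ⟨ b , ⟨ c , x ⟩ ⟩ in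
                 nextState (step s k) a ⟨ b , ⟨ c , x ⟩ ⟩ , π₁ ∘ y , π₁ ∘ (π₂ ∘ y)
      ; out    = λ k (a , b , c) x →
                 π₂ ∘ (π₂ ∘ output (step s k) a ⟨ b , ⟨ c , x ⟩ ⟩)
      }

    vanishing⊗ : tr Q q (tr P p s) ≈ˢ
                 tr (P ⊗ˢ Q) ⟨ p , q ⟩
                    (castˢ (λ k → sym (assocˢ P Q X k))
                           (λ k → sym (assocˢ (◯ P) (◯ Q) Y k)) s)
    vanishing⊗ = realises⇒≈ˢ vanishing⊗Machine
      record
        -- The two layouts differ only in brackets: nested traces append `b` and then `c`, the joint
        -- trace appends their pair.
        { ⟦_⟧    = λ (a , b , c) → ⟨ ⟨ a , b ⟩ , c ⟩
        ; init-≈ = ⟨⟩-∘ (⟨⟩-∘ ≈.refl ≈.refl) ≈.refl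
        ; step-↦ = λ _ _ → ⌊⌉-↦ (⌊⌉-↦ step-↦₃)
        }
      record
        { ⟦_⟧    = λ (a , b , c) → ⟨ a , ⟨ b , c ⟩ ⟩
        ; init-≈ = ⟨⟩-∘ ≈.refl (⟨⟩-∘ ≈.refl ≈.refl)
        ; step-↦ = λ _ _ → ⌊⌉-↦ (subst₂-↦ _ _
                     -- Here the cast runs against associativity, to gather `P k ⊗ Q k` into one
                     -- feedback factor.
                     (≈[]-sym (⊗-assoc _ _ _) ⊗-assoc-≈)
                     (≈[]-sym (⊗-assoc _ _ _) ⊗-assoc-≈) step-↦₃)
        }
      where
      -- Both realisations rest on this evaluation, with the output split into the two values fed
      -- back and the one emitted.
      step-↦₃ : ∀ {k A} {a : Hom A (state s k)} {x} →
                let y = output (step s k) a x in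
                step s k [ a , x ]↦[ nextState (step s k) a x ,
                                     ⟨ π₁ ∘ y , ⟨ π₁ ∘ (π₂ ∘ y) , π₂ ∘ (π₂ ∘ y) ⟩ ⟩ ]
      step-↦₃ = ↦-resp ≈.refl (⟨⟩-cong ≈.refl ⟨⟩-η) (↦-total₂ (step s _))

proposition20 : ∀ {o ℓ e} (ℂ : StrictCartesianCategory o ℓ e) →
    let open StrictCartesianCategory ℂ
        open Stateful ℂ
    in
      -- target naturality
      (∀ (T : Objs) {X Y Z : Objs} (q : Hom 𝟏 (T 0))
         (s : Seq (T ⊗ˢ X) (◯ T ⊗ˢ Y)) (r : Seq Y Z) →
         r ∘ˢ tr T q s ≈ˢ tr T q ((idˢ ⊗₁ r) ∘ˢ s))
      ×
      -- source naturality
      (∀ (T : Objs) {W X Y : Objs} (q : Hom 𝟏 (T 0))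
         (s : Seq (T ⊗ˢ X) (◯ T ⊗ˢ Y)) (t : Seq W X) →
         tr T q s ∘ˢ t ≈ˢ tr T q (s ∘ˢ (idˢ ⊗₁ t)))
      ×
      -- superposing
      (∀ (T : Objs) {W X Y Z : Objs} (q : Hom 𝟏 (T 0))
         (s : Seq (T ⊗ˢ X) (◯ T ⊗ˢ Y)) (p : Seq W Z) →
         tr T q s ⊗₁ p ≈ˢ
         tr T q (castˢ (assocˢ T X W) (assocˢ (◯ T) Y Z) (s ⊗₁ p)))
      ×
      -- vanishing 1
      (∀ {X Y : Objs} (s : Seq (𝟏ˢ ⊗ˢ X) (◯ 𝟏ˢ ⊗ˢ Y)) →
         tr 𝟏ˢ id s ≈ˢ castˢ (unitˡˢ X) (unitˡˢ Y) s)
      ×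
      -- vanishing ×
      (∀ (U V : Objs) {X Y : Objs} (p : Hom 𝟏 (U 0)) (q : Hom 𝟏 (V 0))
         (s : Seq (U ⊗ˢ (V ⊗ˢ X)) (◯ U ⊗ˢ (◯ V ⊗ˢ Y))) →
         tr V q (tr U p s) ≈ˢ
         tr (U ⊗ˢ V) ⟨ p , q ⟩
            (castˢ (λ k → sym (assocˢ U V X k))
                   (λ k → sym (assocˢ (◯ U) (◯ V) Y k)) s))
proposition20 ℂ =
  (λ T → target-naturality) , (λ T → source-naturality) ,
  (λ T → superposing) , vanishing₁ , (λ U V → vanishing⊗)
  where open GeneralizedElements ℂ
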